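{- If $X\subseteq\mathbb{Z}^2\setminus\{O\}$ is an arbitrary finite step set, then $X$ has either the Finite Paths Property (FPP) or the Infinite Paths Property (IPP).
   Context: Write $O=(0,0)$. A step set is any subset $X$ of $\mathbb{Z}^2\setminus\{O\}$. $\mathcal{F}_X$ is the free monoid on $X$ (all finite words over $X$, including the empty word), $\mathcal{A}_X$ is the additive submonoid of $\mathbb{Z}^2$ generated by $X$, and $\alpha_X:\mathcal{F}_X\to\mathcal{A}_X$ is given by $\alpha_X(A_1\cdots A_k)=A_1+\cdots+A_k$. For $A\in\mathbb{Z}^2$, $\pi_X(A)$ is the (possibly infinite) number of words $w\in\mathcal{F}_X$ with $\alpha_X(w)=A$. $X$ has the FPP if $\pi_X(A)<\infty$ for all $A\in\mathcal{A}_X$, and the IPP if $\pi_X(A)=\infty$ for all $A\in\mathcal{A}_X$. -}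

module Defs where

open import Level using (Level)
open import Data.Integer using (ℤ; 0ℤ; _+_)
open import Data.List using (List; foldr)
import Data.List.Membership.Propositional as List
open import Data.List.Relation.Unary.All using (All)
open import Data.Product using (_×_; _,_; zip; ∃-syntax)
open import Function using (_⇔_)
open import Relation.Binary.PropositionalEquality using (_≡_)
open import Relation.Nullary using (¬_)
open import Relation.Unary using (Pred; _∈_; _⊆_)

private
  variable
    a ℓ : Level

-- A subset is finite when its elements are exactly the entries of some list
-- (repetitions in the list are harmless).
Finite : {T : Set a} → Pred T ℓ → Set _
Finite P = ∃[ xs ] (∀ x → x ∈ P ⇔ x List.∈ xs)

Infinite : {T : Set a} → Pred T ℓ → Set _
Infinite P = ¬ Finite P

ℤ² : Set
ℤ² = ℤ × ℤ

O : ℤ²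
O = 0ℤ , 0ℤ

infixl 6 _⊕_

_⊕_ : ℤ² → ℤ² → ℤ²
_⊕_ = zip _+_ _+_

-- The free monoid on X, as a submonoid of List ℤ²: two words are equal iff
-- they have the same letters, irrespective of the proofs of membership in X.
𝓕 : Pred ℤ² ℓ → Pred (List ℤ²) ℓ
𝓕 X = All X

data 𝓐 (X : Pred ℤ² ℓ) : Pred ℤ² ℓ where
  gen  : X ⊆ 𝓐 X
  zero : O ∈ 𝓐 X
  add  : ∀ {A B} → A ∈ 𝓐 X → B ∈ 𝓐 X → A ⊕ B ∈ 𝓐 X

α : List ℤ² → ℤ²
α = foldr _⊕_ O

-- The set of words whose (possibly infinite) cardinality is π_X(A).
Π : Pred ℤ² ℓ → ℤ² → Pred (List ℤ²) ℓ
Π X A w = w ∈ 𝓕 X × α w ≡ A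

FPP : Pred ℤ² ℓ → Set ℓ
FPP X = ∀ A → A ∈ 𝓐 X → Finite (Π X A)

IPP : Pred ℤ² ℓ → Set ℓ
IPP X = ∀ A → A ∈ 𝓐 X → Infinite (Π X A)

{-# OPTIONS --safe #-}

-- By Gordan's alternative, either some nonempty word over X has sum O, or some
-- linear functional u is positive on X.  In the first case, powers of the null
-- word can be prepended to any word, so every π_X(A) is infinite.  In the
-- second, u · x ≥ 1 for each letter bounds the length of a word with sum A by
-- u · A, so only finitely many words over the finite alphabet X remain.
module Submission where

open import Level using (Level)
open import Data.Empty using (⊥-elim)
open import Data.Integer hiding (suc)
open import Data.Integer.Properties
open import Data.Integer.Tactic.RingSolver using (solve-∀)
open import Data.List
  using (List; []; _∷_; [_]; _++_; length; replicate; filter; cartesianProductWith)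
open import Data.List.Extrema.Nat using (argmax; f[xs]≤f[argmax])
open import Data.List.Membership.Propositional as List using (find)
open import Data.List.Membership.Propositional.Properties
  using (∈-cartesianProductWith⁺; ∈-cartesianProductWith⁻; ∈-filter⁺; ∈-filter⁻)
open import Data.List.Properties using (length-++)
open import Data.List.Relation.Unary.All as All using (All; []; _∷_; all?)
open import Data.List.Relation.Unary.All.Properties using (++⁺; replicate⁺; ¬All⇒Any¬)
open import Data.List.Relation.Unary.Any using (here; there)
open import Data.Nat as ℕ using (ℕ; zero; suc; z≤n; s≤s)
import Data.Nat.Properties as ℕ
open import Data.Product using (_×_; _,_; ∃-syntax)
open import Data.Product.Properties using (≡-dec)
open import Data.Sum using (_⊎_; inj₁; inj₂)
open import Function using (Equivalence; mk⇔)
open import Relation.Binary.Definitions using (DecidableEquality)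
open import Relation.Binary.PropositionalEquality hiding ([_])
open import Relation.Nullary using (yes; no)
open import Relation.Unary using (Pred; _∈_; _∉_; _⊆_)
open import Defs

private
  variable
    ℓ : Level
    P Q : Pred ℤ² ℓ
    i j : ℤ

-- Signs of products and squares of integers

*-pos : 0ℤ < i → 0ℤ < j → 0ℤ < i * j
*-pos (+<+ (s≤s _)) (+<+ (s≤s _)) = +<+ (s≤s z≤n)

*-nonNeg : 0ℤ ≤ i → 0ℤ ≤ j → 0ℤ ≤ i * j
*-nonNeg {+ m} {+ n} _ _ = subst (0ℤ ≤_) (pos-* m n) (+≤+ z≤n)

square-nonNeg : ∀ i → 0ℤ ≤ i * i
square-nonNeg (+ n)    = *-nonNeg {+ n} {+ n} (+≤+ z≤n) (+≤+ z≤n)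
square-nonNeg -[1+ n ] = +≤+ z≤n

square-pos : i ≢ 0ℤ → 0ℤ < i * i
square-pos {+0}       i≢0 = ⊥-elim (i≢0 refl)
square-pos {+[1+ n ]} _   = +<+ (s≤s z≤n)
square-pos { -[1+ n ]} _  = +<+ (s≤s z≤n)

neg≤∣∣ : ∀ i → - i ≤ + ∣ i ∣
neg≤∣∣ +0       = ≤-refl
neg≤∣∣ +[1+ n ] = -≤+
neg≤∣∣ -[1+ n ] = ≤-refl

-- Vectors and linear functionals in the plane

_≟²_ : DecidableEquality ℤ²
_≟²_ = ≡-dec _≟_ _≟_

⊕-assoc : ∀ A B C → (A ⊕ B) ⊕ C ≡ A ⊕ (B ⊕ C)
⊕-assoc (a , a′) (b , b′) (c , c′) = cong₂ _,_ (+-assoc a b c) (+-assoc a′ b′ c′)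

⊕-identityˡ : ∀ A → O ⊕ A ≡ A
⊕-identityˡ (a , a′) = cong₂ _,_ (+-identityˡ a) (+-identityˡ a′)

⊕-identityʳ : ∀ A → A ⊕ O ≡ A
⊕-identityʳ (a , a′) = cong₂ _,_ (+-identityʳ a) (+-identityʳ a′)

infixl 7 _⊛_ _·_
infix 8 ⊝_

_⊛_ : ℤ → ℤ² → ℤ²
c ⊛ (a , b) = c * a , c * b

_·_ : ℤ² → ℤ² → ℤ
(a , b) · (c , d) = a * c + b * d

perp : ℤ² → ℤ²
perp (a , b) = - b , a

⊝_ : ℤ² → ℤ²
⊝ (a , b) = - a , - b

·-zeroʳ : ∀ u → u · O ≡ 0ℤ
·-zeroʳ (a , b) = cong₂ _+_ (*-zeroʳ a) (*-zeroʳ b)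

·-⊕ʳ : ∀ u A B → u · (A ⊕ B) ≡ u · A + u · B
·-⊕ʳ (a , b) (c , d) (e , f) = lemma a b c d e f
  where
  lemma : ∀ a b c d e f → a * (c + e) + b * (d + f) ≡ a * c + b * d + (a * e + b * f)
  lemma = solve-∀

perp·self : ∀ a → perp a · a ≡ 0ℤ
perp·self (a , b) = lemma a b
  where
  lemma : ∀ a b → - b * a + a * b ≡ 0ℤ
  lemma = solve-∀

⊝-· : ∀ u x → ⊝ u · x ≡ - (u · x)
⊝-· (a , b) (c , d) = lemma a b c d
  where
  lemma : ∀ a b c d → - a * c + - b * d ≡ - (a * c + b * d)
  lemma = solve-∀

·-linearˡ : ∀ c v a x → (c ⊛ v ⊕ a) · x ≡ c * (v · x) + a · x
·-linearˡ c (v , v′) (a , a′) (x , x′) = lemma c v v′ a a′ x x′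
  where
  lemma : ∀ c v v′ a a′ x x′ →
    (c * v + a) * x + (c * v′ + a′) * x′ ≡ c * (v * x + v′ * x′) + (a * x + a′ * x′)
  lemma = solve-∀

self·self-pos : ∀ {a} → a ≢ O → 0ℤ < a · a
self·self-pos {a , b} a≢O with a ≟ 0ℤ
... | no a≢0    = +-mono-<-≤ (square-pos a≢0) (square-nonNeg b)
... | yes refl  = +-mono-≤-< (≤-refl {0ℤ}) (square-pos λ b≡0 → a≢O (cong (0ℤ ,_) b≡0))

-- The combination (u · x) a − (u · a) x is orthogonal to u, so it is a multiple of
-- perp u, namely by − perp a · x.
orthogonal-relation : ∀ u a x y p q → p * (perp a · x) + q * (perp a · y) ≡ 0ℤ →
  (p * (u · x) + q * (u · y)) ⊛ a ⊕ ((p * - (u · a)) ⊛ x ⊕ (q * - (u · a)) ⊛ y) ≡ O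
orthogonal-relation (u , v) (a , b) (x , x′) (y , y′) p q eq = cong₂ _,_
  (trans (first u v a b x x′ y y′ p q) (trans (cong (v *_) eq) (*-zeroʳ v)))
  (trans (second u v a b x x′ y y′ p q) (trans (cong (- u *_) eq) (*-zeroʳ (- u))))
  where
  first : ∀ u v a b x x′ y y′ p q →
    (p * (u * x + v * x′) + q * (u * y + v * y′)) * a
      + (p * - (u * a + v * b) * x + q * - (u * a + v * b) * y)
    ≡ v * (p * (- b * x + a * x′) + q * (- b * y + a * y′))
  first = solve-∀
  second : ∀ u v a b x x′ y y′ p q →
    (p * (u * x + v * x′) + q * (u * y + v * y′)) * b
      + (p * - (u * a + v * b) * x′ + q * - (u * a + v * b) * y′)
    ≡ - u * (p * (- b * x + a * x′) + q * (- b * y + a * y′))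
  second = solve-∀


-- A large multiple of `v` dominates the contribution of `a` on `xs`, while at `a` itself `v`
-- vanishes and only `a · a` is left.
perturb : ∀ {a} v {xs} → a ≢ O → v · a ≡ 0ℤ → All (λ x → 0ℤ < v · x) xs →
  ∃[ u ] All (λ x → 0ℤ < u · x) (a ∷ xs)
perturb {a} v {xs} a≢O v·a≡0 v·xs>0 = u , u·a>0 ∷ All.zipWith u·x>0 (v·xs>0 , bounded)
  where
  size : ℤ² → ℕ
  size x = ∣ a · x ∣
  m : ℕ
  -- The default `O` has size 0, so `m` is the largest size in `xs`, and 0 for empty `xs`.
  m = size (argmax size O xs)
  u : ℤ²
  u = +[1+ m ] ⊛ v ⊕ a
  bounded : All (λ x → size x ℕ.≤ m) xs
  bounded = f[xs]≤f[argmax] {f = size} O xs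
  open ≤-Reasoning
  u·a>0 : 0ℤ < u · a
  u·a>0 = begin-strict
    0ℤ                         <⟨ self·self-pos a≢O ⟩
    a · a                      ≡⟨ +-identityˡ (a · a) ⟨
    0ℤ + a · a                 ≡⟨ cong (_+ a · a) (*-zeroʳ +[1+ m ]) ⟨
    +[1+ m ] * 0ℤ + a · a      ≡⟨ cong (λ z → +[1+ m ] * z + a · a) v·a≡0 ⟨
    +[1+ m ] * (v · a) + a · a ≡⟨ ·-linearˡ +[1+ m ] v a a ⟨
    u · a                      ∎
  u·x>0 : ∀ {x} → 0ℤ < v · x × size x ℕ.≤ m → 0ℤ < u · x
  u·x>0 {x} (v·x>0 , ∣a·x∣≤m) = begin-strict
    0ℤ                         ≡⟨ +-inverseˡ (a · x) ⟨
    - (a · x) + a · x          <⟨ +-monoˡ-< (a · x) -a·x< ⟩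
    +[1+ m ] * (v · x) + a · x ≡⟨ ·-linearˡ +[1+ m ] v a x ⟨
    u · x                      ∎
    where
    -a·x< : - (a · x) < +[1+ m ] * (v · x)
    -a·x< = begin-strict
      - (a · x)          ≤⟨ neg≤∣∣ (a · x) ⟩
      + size x           <⟨ +<+ (s≤s ∣a·x∣≤m) ⟩
      +[1+ m ]           ≡⟨ *-identityʳ +[1+ m ] ⟨
      -- Integrality enters here: a positive `v · x` is at least 1, so the factor `m + 1` already
      -- beats every size.
      +[1+ m ] * 1ℤ      ≤⟨ *-monoˡ-≤-nonNeg +[1+ m ] (i<j⇒suc[i]≤j v·x>0) ⟩
      +[1+ m ] * (v · x) ∎

-- Null words and Gordan's alternative

α-++ : ∀ v w → α (v ++ w) ≡ α v ⊕ α w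
α-++ []      w = sym (⊕-identityˡ (α w))
α-++ (A ∷ v) w = trans (cong (A ⊕_) (α-++ v w)) (sym (⊕-assoc A (α v) (α w)))

α-replicate : ∀ n A → α (replicate n A) ≡ + n ⊛ A
α-replicate zero    (a , b) = refl
α-replicate (suc n) A@(a , b) = trans (cong (A ⊕_) (α-replicate n A))
  (sym (cong₂ _,_ (suc-* (+ n) a) (suc-* (+ n) b)))

-- The length condition excludes the empty word, whose sum is always `O`.
NullWord : Pred ℤ² ℓ → Set ℓ
NullWord P = ∃[ w ] 1 ℕ.≤ length w × w ∈ Π P O

NullWord-map : P ⊆ Q → NullWord P → NullWord Q
NullWord-map P⊆Q (w , w≢[] , w∈P , αw≡O) = w , w≢[] , All.map P⊆Q w∈P , αw≡O

-- The coefficients serve as multiplicities of the letters; `c > 0` makes the word nonempty.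
relation⇒NullWord : ∀ {a x y c d e} → a ∈ P → x ∈ P → y ∈ P →
  0ℤ < c → 0ℤ ≤ d → 0ℤ ≤ e → c ⊛ a ⊕ (d ⊛ x ⊕ e ⊛ y) ≡ O → NullWord P
relation⇒NullWord {a = a} {x} {y} {c@(+[1+ k ])} {d@(+ m)} {e@(+ n)} a∈P x∈P y∈P _ _ _ eq =
  w , s≤s z≤n , ++⁺ (replicate⁺ (suc k) a∈P) (++⁺ (replicate⁺ m x∈P) (replicate⁺ n y∈P)) , αw≡O
  where
  w = replicate (suc k) a ++ replicate m x ++ replicate n y
  open ≡-Reasoning
  αw≡O : α w ≡ O
  αw≡O = begin
    α w
      ≡⟨ α-++ (replicate (suc k) a) _ ⟩
    α (replicate (suc k) a) ⊕ α (replicate m x ++ replicate n y)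
      ≡⟨ cong (α (replicate (suc k) a) ⊕_) (α-++ (replicate m x) _) ⟩
    α (replicate (suc k) a) ⊕ (α (replicate m x) ⊕ α (replicate n y))
      ≡⟨ cong₂ _⊕_ (α-replicate (suc k) a) (cong₂ _⊕_ (α-replicate m x) (α-replicate n y)) ⟩
    c ⊛ a ⊕ (d ⊛ x ⊕ e ⊛ y)
      ≡⟨ eq ⟩
    O ∎
relation⇒NullWord {c = +0} _ _ _ (+<+ ()) _ _ _

-- In `orthogonal-relation`, `p > 0` makes the coefficient of `a` positive, and `u · a ≤ 0` makes
-- those of `x` and `y` nonnegative.
perp-relation⇒NullWord : ∀ u {a x y} p q → a ∈ P → x ∈ P → y ∈ P →
  0ℤ < u · x → 0ℤ < u · y → u · a ≤ 0ℤ → 0ℤ < p → 0ℤ ≤ q →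
  p * (perp a · x) + q * (perp a · y) ≡ 0ℤ → NullWord P
perp-relation⇒NullWord u {a} {x} {y} p q a∈P x∈P y∈P u·x>0 u·y>0 u·a≤0 p>0 q≥0 eq =
  relation⇒NullWord a∈P x∈P y∈P
    (+-mono-<-≤ (*-pos p>0 u·x>0) (*-nonNeg q≥0 (<⇒≤ u·y>0)))
    (*-nonNeg (<⇒≤ p>0) (neg-mono-≤ u·a≤0))
    (*-nonNeg q≥0 (neg-mono-≤ u·a≤0))
    (orthogonal-relation u a x y p q eq)

-- If u fails at the new vector a, then either xs lies strictly on one side of the line
-- through a, and the normal of that line tilted towards a is positive everywhere, or xs
-- has x and y weakly on opposite sides.  The vectors (u · x) a − (u · a) x and its
-- analogue for y are then opposite multiples of perp u and cancel, while a keeps a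
-- positive coefficient.
gordan : ∀ xs → All (_≢ O) xs → NullWord (List._∈ xs) ⊎ ∃[ u ] All (λ x → 0ℤ < u · x) xs
gordan [] [] = inj₂ (O , [])
gordan (a ∷ xs) (a≢O ∷ xs≢O) with gordan xs xs≢O
... | inj₁ null = inj₁ (NullWord-map there null)
... | inj₂ (u , u·xs>0)
  with 0ℤ <? u · a | all? (λ x → 0ℤ <? perp a · x) xs | all? (λ x → 0ℤ <? ⊝ perp a · x) xs
... | yes u·a>0 | _ | _ = inj₂ (u , u·a>0 ∷ u·xs>0)
... | no _ | yes left | _ = inj₂ (perturb (perp a) a≢O (perp·self a) left)
... | no _ | no _ | yes right =
  inj₂ (perturb (⊝ perp a) a≢O (trans (⊝-· (perp a) a) (cong -_ (perp·self a))) right)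
... | no u·a≯0 | no ¬left | no ¬right
  with x , x∈xs , ¬x-left ← find (¬All⇒Any¬ (λ x → 0ℤ <? perp a · x) xs ¬left)
  with y , y∈xs , ¬y-right ← find (¬All⇒Any¬ (λ x → 0ℤ <? ⊝ perp a · x) xs ¬right)
  -- So far `perp a · x ≤ 0 ≤ perp a · y`. The weight of `x` will be `perp a · y`, which must not
  -- vanish, so `y` on the line through `a` is a separate case.
  with 0ℤ <? perp a · y
... | yes y-left = inj₁ (perp-relation⇒NullWord u (perp a · y) (- (perp a · x))
        (here refl) (there x∈xs) (there y∈xs)
        (All.lookup u·xs>0 x∈xs) (All.lookup u·xs>0 y∈xs) (≮⇒≥ u·a≯0)
        y-left (neg-mono-≤ (≮⇒≥ ¬x-left)) (lemma (perp a · x) (perp a · y)))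
  where
  lemma : ∀ i j → j * i + - i * j ≡ 0ℤ
  lemma = solve-∀
-- Now `y` lies on the line through `a`, so `a` and `y` suffice; `y` also fills the slot of the
-- third letter, with weight 0.
... | no ¬y-left = inj₁ (perp-relation⇒NullWord u {y = y} 1ℤ 0ℤ
        (here refl) (there y∈xs) (there y∈xs)
        (All.lookup u·xs>0 y∈xs) (All.lookup u·xs>0 y∈xs) (≮⇒≥ u·a≯0)
        (+<+ (s≤s z≤n)) ≤-refl
        (trans (lemma (perp a · y)) y-on))
  where
  lemma : ∀ i → 1ℤ * i + 0ℤ * i ≡ i
  lemma = solve-∀
  y-on : perp a · y ≡ 0ℤ
  y-on = ≤-antisym (≮⇒≥ ¬y-left)
    (neg-cancel-≤ (subst (_≤ 0ℤ) (⊝-· (perp a) y) (≮⇒≥ ¬y-right)))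

-- Infinitely many words from a null word

𝓐⇒word : ∀ {A} → A ∈ 𝓐 P → ∃[ w ] w ∈ Π P A
𝓐⇒word (gen {A} A∈P) = [ A ] , A∈P ∷ [] , ⊕-identityʳ A
𝓐⇒word zero = [] , [] , refl
𝓐⇒word (add A∈𝓐 B∈𝓐) with v , v∈P , refl ← 𝓐⇒word A∈𝓐 | w , w∈P , refl ← 𝓐⇒word B∈𝓐 =
  v ++ w , ++⁺ v∈P w∈P , α-++ v w

Π-unbounded : NullWord P → ∀ {A} → A ∈ 𝓐 P → ∀ n → ∃[ w ] w ∈ Π P A × n ℕ.≤ length w
Π-unbounded _ A∈𝓐 zero with w , w∈Π ← 𝓐⇒word A∈𝓐 = w , w∈Π , z≤n
Π-unbounded null@(z , z≢[] , z∈P , αz≡O) A∈𝓐 (suc n)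
  with w , (w∈P , refl) , n≤∣w∣ ← Π-unbounded null A∈𝓐 n =
  z ++ w ,
  (++⁺ z∈P w∈P , trans (α-++ z w) (trans (cong (_⊕ α w) αz≡O) (⊕-identityˡ (α w)))) ,
  subst (suc n ℕ.≤_) (sym (length-++ z)) (ℕ.+-mono-≤ z≢[] n≤∣w∣)

NullWord⇒IPP : NullWord P → IPP P
NullWord⇒IPP null A A∈𝓐 (ws , ws-complete)
  -- A supposed complete list `ws` misses a word longer than all its entries; the default `[]`
  -- covers an empty `ws`.
  with w , w∈Π , long ← Π-unbounded null A∈𝓐 (suc (length (argmax length [] ws))) =
  ℕ.<⇒≱ long
    (All.lookup (f[xs]≤f[argmax] {f = length} [] ws) (Equivalence.to (ws-complete w) w∈Π))

-- Finitely many words from a positive functional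

words≤ : List ℤ² → ℕ → List (List ℤ²)
words≤ xs zero    = [ [] ]
-- Adding `[]` at every level makes `n` an upper bound on the length instead of its exact value.
words≤ xs (suc n) = [] ∷ cartesianProductWith _∷_ xs (words≤ xs n)

∈-words≤⁺ : ∀ {xs w n} → All (List._∈ xs) w → length w ℕ.≤ n → w List.∈ words≤ xs n
∈-words≤⁺ {n = zero}  []            _         = here refl
∈-words≤⁺ {n = suc _} []            _         = here refl
∈-words≤⁺ {n = suc _} (A∈xs ∷ w∈xs) (s≤s w≤n) =
  there (∈-cartesianProductWith⁺ _∷_ A∈xs (∈-words≤⁺ w∈xs w≤n))

∈-words≤⁻ : ∀ {xs w} n → w List.∈ words≤ xs n → All (List._∈ xs) w
∈-words≤⁻ zero    (here refl) = []
∈-words≤⁻ (suc n) (here refl) = []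
∈-words≤⁻ {xs} (suc n) (there w∈)
  with _ , _ , A∈xs , v∈ , refl ← ∈-cartesianProductWith⁻ _∷_ xs (words≤ xs n) w∈ =
  A∈xs ∷ ∈-words≤⁻ n v∈

length≤·α : ∀ u {w} → All (λ x → 0ℤ < u · x) w → + length w ≤ u · α w
length≤·α u []                      = ≤-reflexive (sym (·-zeroʳ u))
length≤·α u {A ∷ w} (u·A>0 ∷ u·w>0) = subst (+ suc (length w) ≤_) (sym (·-⊕ʳ u A (α w)))
  (+-mono-≤ (i<j⇒suc[i]≤j u·A>0) (length≤·α u u·w>0))

positive⇒FPP : Finite P → ∀ u → (∀ {x} → x ∈ P → 0ℤ < u · x) → FPP P
positive⇒FPP {P = P} (xs , P⇔xs) u u·P>0 A _ =
  filter (λ w → α w ≟² A) (words≤ xs n) , λ w → mk⇔ to from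
  where
  n : ℕ
  n = ∣ u · A ∣
  to : ∀ {w} → w ∈ Π P A → w List.∈ filter (λ w → α w ≟² A) (words≤ xs n)
  to {w} (w∈P , refl) = ∈-filter⁺ (λ w → α w ≟² A)
    (∈-words≤⁺ (All.map (Equivalence.to (P⇔xs _)) w∈P)
      -- A length is nonnegative, so `len` forces `u · A` to be nonnegative and hence equal to its
      -- absolute value `n`.
      (drop‿+≤+ (≤-trans len (≤-reflexive (sym (0≤i⇒+∣i∣≡i (≤-trans (+≤+ z≤n) len)))))))
    refl
    where
    len = length≤·α u (All.map u·P>0 w∈P)
  from : ∀ {w} → w List.∈ filter (λ w → α w ≟² A) (words≤ xs n) → w ∈ Π P A
  from w∈ with w∈words , αw≡A ← ∈-filter⁻ (λ w → α w ≟² A) {xs = words≤ xs n} w∈ =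
    All.map (Equivalence.from (P⇔xs _)) (∈-words≤⁻ n w∈words) , αw≡A

corollary2p29 : ∀ {ℓ : Level} (X : Pred ℤ² ℓ) → O ∉ X → Finite X → FPP X ⊎ IPP X
corollary2p29 X O∉X (xs , X⇔xs)
  with gordan xs (All.tabulate λ x∈xs → λ { refl → O∉X (Equivalence.from (X⇔xs _) x∈xs) })
... | inj₁ null = inj₂ (NullWord⇒IPP (NullWord-map (Equivalence.from (X⇔xs _)) null))
... | inj₂ (u , u·xs>0) =
  inj₁ (positive⇒FPP (xs , X⇔xs) u λ x∈X → All.lookup u·xs>0 (Equivalence.to (X⇔xs _) x∈X))
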